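{- Let $G$ be a group, $g,h\in G$, and $k=\min\{|G:C_G(g)|,|G:C_G(h)|\}$, assumed finite. If the set $\{x\in G:[g,h^x]=1\}$ is $k$-large in $G$, then every element of the conjugacy class $g^G$ commutes with every element of the conjugacy class $h^G$.
   Context: $[a,b]=a^{ -1}b^{ -1}ab$, $a^x=x^{ -1}ax$. A subset $X\subseteq G$ is $k$-large in $G$ if the intersection of any $k$ left translates $a_1X\cap\dots\cap a_kX$ ($a_i\in G$) is non-empty. -}

module Defs where

open import Algebra.Bundles using (Group)
import Algebra.Properties.Group as GroupProperties
open import Data.Fin.Base using (Fin)
open import Data.Nat.Base using (ℕ; _≤_)
open import Data.Product.Base using (∃-syntax; _×_; _,_)
open import Function.Bundles using (Bijection)
open import Level using (Level; _⊔_) renaming (suc to lsuc)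
open import Relation.Binary.Bundles using (Setoid)
open import Relation.Binary.Definitions using (_Respects_)
open import Relation.Binary.PropositionalEquality using (setoid)
open import Relation.Unary using (Pred; _∈_; _∪_; ⋂; Satisfiable)
import Relation.Binary.Reasoning.Setoid as SetoidReasoning

IsLeast : ∀ {p} → Pred ℕ p → ℕ → Set p
IsLeast P k = k ∈ P × (∀ m → m ∈ P → k ≤ m)

module GroupDefs {c ℓ : Level} (G : Group c ℓ) where

  open Group G hiding (setoid)
  open GroupProperties G using (⁻¹-anti-homo-∙; ⁻¹-involutive)

  private variable p : Level

  infixl 8 _^_

  _^_ : Carrier → Carrier → Carrier
  a ^ x = x ⁻¹ ∙ a ∙ x

  [_,_] : Carrier → Carrier → Carrier
  [ a , b ] = a ⁻¹ ∙ b ⁻¹ ∙ a ∙ b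

  ConjugacyClass : Carrier → Pred Carrier (c ⊔ ℓ)
  ConjugacyClass a b = ∃[ x ] b ≈ a ^ x

  Commute : Carrier → Carrier → Set ℓ
  Commute a b = a ∙ b ≈ b ∙ a

  LeftTranslate : Carrier → Pred Carrier p → Pred Carrier (c ⊔ ℓ ⊔ p)
  LeftTranslate a X y = ∃[ x ] x ∈ X × y ≈ a ∙ x

  -- The translating elements a₁ , … , aₖ need not be distinct.
  Large : ℕ → Pred Carrier p → Set (c ⊔ ℓ ⊔ p)
  Large k X = (a : Fin k → Carrier) →
              Satisfiable (⋂ (Fin k) (λ i → LeftTranslate (a i) X))

  record Subgroup (p : Level) : Set (c ⊔ ℓ ⊔ lsuc p) where
    field
      Member    : Pred Carrier p
      resp      : Member Respects _≈_
      ε-closed  : ε ∈ Member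
      ∙-closed  : ∀ {x y} → x ∈ Member → y ∈ Member → x ∙ y ∈ Member
      ⁻¹-closed : ∀ {x} → x ∈ Member → x ⁻¹ ∈ Member

  -- The left cosets of H, each represented by its elements:
  -- xH = yH if and only if x⁻¹y ∈ H.
  LeftCosets : Subgroup p → Setoid c p
  LeftCosets H = record
    { Carrier       = Carrier
    ; _≈_           = λ x y → x ⁻¹ ∙ y ∈ Member
    ; isEquivalence = record
      { refl  = λ {x} → resp (sym (inverseˡ x)) ε-closed
      ; sym   = λ {x} {y} q → resp (flip x y) (⁻¹-closed q)
      ; trans = λ {x} {y} {z} q r → resp (compose x y z) (∙-closed q r)
      }
    }
    where
    open Subgroup H
    open SetoidReasoning (Group.setoid G)

    flip : ∀ x y → (x ⁻¹ ∙ y) ⁻¹ ≈ y ⁻¹ ∙ x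
    flip x y = trans (⁻¹-anti-homo-∙ (x ⁻¹) y) (∙-congˡ (⁻¹-involutive x))

    compose : ∀ x y z → (x ⁻¹ ∙ y) ∙ (y ⁻¹ ∙ z) ≈ x ⁻¹ ∙ z
    compose x y z = begin
      (x ⁻¹ ∙ y) ∙ (y ⁻¹ ∙ z)  ≈⟨ assoc _ _ _ ⟩
      x ⁻¹ ∙ (y ∙ (y ⁻¹ ∙ z))  ≈⟨ ∙-congˡ (assoc _ _ _) ⟨
      x ⁻¹ ∙ ((y ∙ y ⁻¹) ∙ z)  ≈⟨ ∙-congˡ (∙-congʳ (inverseʳ y)) ⟩
      x ⁻¹ ∙ (ε ∙ z)           ≈⟨ ∙-congˡ (identityˡ z) ⟩
      x ⁻¹ ∙ z                 ∎

  -- H has finite index n; a subgroup of infinite index has no such n.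
  HasIndex : Subgroup p → Pred ℕ (c ⊔ p)
  HasIndex H n = Bijection (setoid (Fin n)) (LeftCosets H)

  Centralizer : Carrier → Subgroup ℓ
  Centralizer g = record
    { Member    = λ x → Commute x g
    ; resp      = λ x≈y q → trans (∙-congʳ (sym x≈y)) (trans q (∙-congˡ x≈y))
    ; ε-closed  = trans (identityˡ g) (sym (identityʳ g))
    ; ∙-closed  = λ {x} {y} q r → begin
        (x ∙ y) ∙ g  ≈⟨ assoc x y g ⟩
        x ∙ (y ∙ g)  ≈⟨ ∙-congˡ r ⟩
        x ∙ (g ∙ y)  ≈⟨ assoc x g y ⟨
        (x ∙ g) ∙ y  ≈⟨ ∙-congʳ q ⟩
        (g ∙ x) ∙ y  ≈⟨ assoc g x y ⟩
        g ∙ (x ∙ y)  ∎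
    ; ⁻¹-closed = λ {x} q → begin
        x ⁻¹ ∙ g                 ≈⟨ identityʳ _ ⟨
        (x ⁻¹ ∙ g) ∙ ε           ≈⟨ ∙-congˡ (inverseʳ x) ⟨
        (x ⁻¹ ∙ g) ∙ (x ∙ x ⁻¹)  ≈⟨ assoc _ _ _ ⟨
        ((x ⁻¹ ∙ g) ∙ x) ∙ x ⁻¹  ≈⟨ ∙-congʳ (assoc _ _ _) ⟩
        (x ⁻¹ ∙ (g ∙ x)) ∙ x ⁻¹  ≈⟨ ∙-congʳ (∙-congˡ q) ⟨
        (x ⁻¹ ∙ (x ∙ g)) ∙ x ⁻¹  ≈⟨ ∙-congʳ (assoc _ _ _) ⟨
        ((x ⁻¹ ∙ x) ∙ g) ∙ x ⁻¹  ≈⟨ ∙-congʳ (∙-congʳ (inverseˡ x)) ⟩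
        (ε ∙ g) ∙ x ⁻¹           ≈⟨ ∙-congʳ (identityˡ g) ⟩
        g ∙ x ⁻¹                 ∎
    }
    where open SetoidReasoning (Group.setoid G)

  -- k = min { |G : C_G(g)| , |G : C_G(h)| }, assumed finite.  An infinite index
  -- contributes nothing to the set of indices, so one of the two may be infinite.
  IsMinIndex : Carrier → Carrier → Pred ℕ (c ⊔ ℓ)
  IsMinIndex g h = IsLeast (HasIndex (Centralizer g) ∪ HasIndex (Centralizer h))

{-# OPTIONS --safe #-}
-- Let X = {x : g commutes with h^x}.  It is a union of left cosets of C(g) and
-- of right cosets of C(h), and the theorem says that X = G.  Fix z and
-- representatives t₁ , … , tₖ of the left cosets of the centralizer C of index k.
-- If C = C(g), take y in every translate tᵢz⁻¹X and i with y ∈ tᵢC: then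
-- zC = ztᵢ⁻¹yC lies in X.  If C = C(h), take y in every translate tᵢX and i with
-- yz⁻¹ ∈ tᵢC: then Cz = Ctᵢ⁻¹y lies in X.
module Submission where

open import Algebra.Bundles using (Group)
import Algebra.Properties.Group as GroupProperties
open import Data.Nat.Base using (ℕ)
open import Data.Product.Base using (∃-syntax; _,_; map₂)
open import Data.Sum.Base using (inj₁; inj₂)
open import Function.Bundles using (module Bijection)
open import Level using (Level)
open import Relation.Binary.Definitions using (_Respects_)
import Relation.Binary.Reasoning.Setoid as SetoidReasoning
open import Relation.Unary using (Pred; _∈_; _⊆_)
open import Defs

module _ {c ℓ : Level} (G : Group c ℓ) where

  open Group G
  open GroupDefs G
  open GroupProperties G
  open SetoidReasoning setoid

  private variable
    p q : Level
    a b x y : Carrier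
    k : ℕ
    H : Subgroup p
    X : Pred Carrier p
    Y : Pred Carrier q

  ^-congʳ : x ≈ y → a ^ x ≈ a ^ y
  ^-congʳ x≈y = ∙-cong (∙-congʳ (⁻¹-cong x≈y)) x≈y

  ^-∙ : ∀ a x y → a ^ (x ∙ y) ≈ (a ^ x) ^ y
  ^-∙ a x y = begin
    ((x ∙ y) ⁻¹ ∙ a) ∙ (x ∙ y)      ≈⟨ ∙-congʳ (∙-congʳ (⁻¹-anti-homo-∙ x y)) ⟩
    ((y ⁻¹ ∙ x ⁻¹) ∙ a) ∙ (x ∙ y)   ≈⟨ assoc _ x y ⟨
    (((y ⁻¹ ∙ x ⁻¹) ∙ a) ∙ x) ∙ y   ≈⟨ ∙-congʳ (∙-congʳ (assoc _ _ a)) ⟩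
    ((y ⁻¹ ∙ (x ⁻¹ ∙ a)) ∙ x) ∙ y   ≈⟨ ∙-congʳ (assoc _ _ x) ⟩
    (y ⁻¹ ∙ ((x ⁻¹ ∙ a) ∙ x)) ∙ y   ∎

  ^-distribʳ-∙ : ∀ x a b → (a ∙ b) ^ x ≈ a ^ x ∙ b ^ x
  ^-distribʳ-∙ x a b = begin
    (x ⁻¹ ∙ (a ∙ b)) ∙ x                   ≈⟨ ∙-congʳ (assoc _ a b) ⟨
    ((x ⁻¹ ∙ a) ∙ b) ∙ x                   ≈⟨ ∙-congʳ (∙-congˡ (\\-leftDividesˡ x b)) ⟨
    ((x ⁻¹ ∙ a) ∙ (x ∙ (x ⁻¹ ∙ b))) ∙ x    ≈⟨ ∙-congʳ (assoc _ x _) ⟨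
    (((x ⁻¹ ∙ a) ∙ x) ∙ (x ⁻¹ ∙ b)) ∙ x    ≈⟨ assoc _ _ x ⟩
    ((x ⁻¹ ∙ a) ∙ x) ∙ ((x ⁻¹ ∙ b) ∙ x)    ∎

  Commute⇒^≈ : Commute x a → a ^ x ≈ a
  Commute⇒^≈ {x} {a} xa≈ax = begin
    (x ⁻¹ ∙ a) ∙ x  ≈⟨ assoc _ a x ⟩
    x ⁻¹ ∙ (a ∙ x)  ≈⟨ ∙-congˡ xa≈ax ⟨
    x ⁻¹ ∙ (x ∙ a)  ≈⟨ \\-leftDividesʳ x a ⟩
    a               ∎

  Commute-resp₂ : a ≈ x → b ≈ y → Commute a b → Commute x y
  Commute-resp₂ a≈x b≈y ab≈ba =
    trans (sym (∙-cong a≈x b≈y)) (trans ab≈ba (∙-cong b≈y a≈x))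

  Commute-^ : ∀ x → Commute a b → Commute (a ^ x) (b ^ x)
  Commute-^ {a} {b} x ab≈ba = begin
    a ^ x ∙ b ^ x  ≈⟨ ^-distribʳ-∙ x a b ⟨
    (a ∙ b) ^ x    ≈⟨ ∙-congʳ (∙-congˡ ab≈ba) ⟩
    (b ∙ a) ^ x    ≈⟨ ^-distribʳ-∙ x b a ⟩
    b ^ x ∙ a ^ x  ∎

  -- The commutator regroups as `(a ⁻¹ ∙ b ⁻¹) ∙ (a ∙ b)`, so `a ∙ b` is the inverse of
  -- `a ⁻¹ ∙ b ⁻¹`.
  [,]≈ε⇒Commute : [ a , b ] ≈ ε → Commute a b
  [,]≈ε⇒Commute {a} {b} eq = begin
    a ∙ b               ≈⟨ inverseʳ-unique _ _ (trans (sym (assoc _ a b)) eq) ⟩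
    (a ⁻¹ ∙ b ⁻¹) ⁻¹    ≈⟨ ⁻¹-anti-homo-∙ _ _ ⟩
    b ⁻¹ ⁻¹ ∙ a ⁻¹ ⁻¹   ≈⟨ ∙-cong (⁻¹-involutive b) (⁻¹-involutive a) ⟩
    b ∙ a               ∎

  Large-mono : X ⊆ Y → Large k X → Large k Y
  Large-mono X⊆Y large a with y , meets ← large a =
    y , λ i → map₂ (λ (x∈X , y≈ax) → X⊆Y x∈X , y≈ax) (meets i)

  coset-representative : (index : HasIndex H k) → ∀ y →
    ∃[ i ] Bijection.to index i ⁻¹ ∙ y ∈ Subgroup.Member H
  coset-representative index = Bijection.strictlySurjective index

  -- The absorption hypothesis makes `X` a union of left cosets of `H`. Since `y` lies in all the
  -- translates at once, `i` may be chosen after `y`, as the coset containing it; there is one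
  -- translate per coset.
  large⇒full-leftCosets : HasIndex H k → X Respects _≈_ →
    (∀ {x s} → s ∈ Subgroup.Member H → x ∙ s ∈ X → x ∈ X) →
    Large k X → ∀ z → z ∈ X
  large⇒full-leftCosets {H = H} index resp absorb large z
    -- The factor `z ⁻¹` is there so that `y ≈ (t ∙ z ⁻¹) ∙ x` puts `x` in the left coset of `z`.
    with y , meets ← large (λ i → Bijection.to index i ∙ z ⁻¹)
    with i , s∈H ← coset-representative {H = H} index y
    with x , x∈X , y≈tz⁻¹x ← meets i = absorb s∈H (resp x≈zs x∈X)
    where
    t = Bijection.to index i
    x≈zs : x ≈ z ∙ (t ⁻¹ ∙ y)
    x≈zs = ∙-cancelˡ (t ∙ z ⁻¹) _ _ (begin
      (t ∙ z ⁻¹) ∙ x                  ≈⟨ y≈tz⁻¹x ⟨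
      y                               ≈⟨ \\-leftDividesˡ t y ⟨
      t ∙ (t ⁻¹ ∙ y)                  ≈⟨ ∙-congʳ (//-rightDividesˡ z t) ⟨
      ((t ∙ z ⁻¹) ∙ z) ∙ (t ⁻¹ ∙ y)   ≈⟨ assoc _ z _ ⟩
      (t ∙ z ⁻¹) ∙ (z ∙ (t ⁻¹ ∙ y))   ∎)

  -- Now `X` is a union of right cosets, while the representatives still come from left cosets. So
  -- `z` enters through the choice of `i`, by the left coset of `y ∙ z ⁻¹`, and not through the
  -- translates.
  large⇒full-rightCosets : HasIndex H k → X Respects _≈_ →
    (∀ {x s} → s ∈ Subgroup.Member H → s ∙ x ∈ X → x ∈ X) →
    Large k X → ∀ z → z ∈ X
  large⇒full-rightCosets {H = H} index resp absorb large z
    with y , meets ← large (Bijection.to index)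
    with i , s∈H ← coset-representative {H = H} index (y ∙ z ⁻¹)
    with x , x∈X , y≈tx ← meets i = absorb s∈H (resp x≈sz x∈X)
    where
    t = Bijection.to index i
    x≈sz : x ≈ (t ⁻¹ ∙ (y ∙ z ⁻¹)) ∙ z
    x≈sz = begin
      x                           ≈⟨ y≈x\\z t x y (sym y≈tx) ⟩
      t ⁻¹ ∙ y                    ≈⟨ ∙-congˡ (//-rightDividesˡ z y) ⟨
      t ⁻¹ ∙ ((y ∙ z ⁻¹) ∙ z)     ≈⟨ assoc _ _ z ⟨
      (t ⁻¹ ∙ (y ∙ z ⁻¹)) ∙ z     ∎

  module _ (g h : Carrier) where

    Commuting : Pred Carrier ℓ
    Commuting x = Commute g (h ^ x)

    Commuting-resp : Commuting Respects _≈_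
    Commuting-resp x≈y = Commute-resp₂ refl (^-congʳ x≈y)

    -- Conjugation by `s ⁻¹` fixes `g` and carries `h ^ (x ∙ s)` to `h ^ x`.
    Commuting-absorbs-C[g] : ∀ {x s} → Commute s g → x ∙ s ∈ Commuting → x ∈ Commuting
    Commuting-absorbs-C[g] {x} {s} s∈C xs∈ = Commute-resp₂
      (Commute⇒^≈ (Subgroup.⁻¹-closed (Centralizer g) s∈C))
      (trans (sym (^-∙ h (x ∙ s) (s ⁻¹))) (^-congʳ (//-rightDividesʳ s x)))
      (Commute-^ (s ⁻¹) xs∈)

    -- Here `s` fixes `h`, so `h ^ (s ∙ x)` and `h ^ x` agree.
    Commuting-absorbs-C[h] : ∀ {x s} → Commute s h → s ∙ x ∈ Commuting → x ∈ Commuting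
    Commuting-absorbs-C[h] {x} {s} s∈C = Commute-resp₂ refl
      (trans (^-∙ h s x) (∙-congʳ (∙-congˡ (Commute⇒^≈ s∈C))))

    Commuting-full : IsMinIndex g h k → Large k Commuting → ∀ z → z ∈ Commuting
    Commuting-full (inj₁ index , _) =
      large⇒full-leftCosets {H = Centralizer g} index Commuting-resp Commuting-absorbs-C[g]
    Commuting-full (inj₂ index , _) =
      large⇒full-rightCosets {H = Centralizer h} index Commuting-resp Commuting-absorbs-C[h]

    -- Conjugating by `x` takes the pair `g`, `h ^ (w ∙ x ⁻¹)` to `g ^ x`, `h ^ w`, and so reduces
    -- two arbitrary conjugates to the case where the first is `g` itself.
    Commuting-full⇒conjugates-commute : (∀ z → z ∈ Commuting) →
      a ∈ ConjugacyClass g → b ∈ ConjugacyClass h → Commute a b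
    Commuting-full⇒conjugates-commute full (x , a≈gˣ) (w , b≈hʷ) = Commute-resp₂
      (sym a≈gˣ)
      (trans (sym (^-∙ h (w ∙ x ⁻¹) x)) (trans (^-congʳ (//-rightDividesˡ x w)) (sym b≈hʷ)))
      (Commute-^ x (full (w ∙ x ⁻¹)))

theorem5p9 : ∀ {c ℓ} (G : Group c ℓ) →
    let open Group G
        open GroupDefs G
    in (g h : Carrier) (k : ℕ) →
       IsMinIndex g h k →
       Large k (λ x → [ g , h ^ x ] ≈ ε) →
       ∀ {a b} → a ∈ ConjugacyClass g → b ∈ ConjugacyClass h → Commute a b
theorem5p9 G g h k min large =
  Commuting-full⇒conjugates-commute G g h
    (Commuting-full G g h min (Large-mono G ([,]≈ε⇒Commute G) large))
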